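{- Let $n>1$ and $t>2$ be two positive integers. Then $\varphi(K_n\boxdot P_t)$ takes the following values in the following cases (nothing is asserted for other pairs $(n,t)$): \[\varphi(K_n\boxdot P_t)=\begin{cases} n+1, & \text{if either } (n=2 \text{ and } t=3) \text{ or } (n\geq 7 \text{ and } t=3),\\ n+2, & \text{if either } (n=2 \text{ and } t>3), \text{ or } n\in\{3,4\}, \text{ or } n\geq 2t+1>7. \end{cases}\]
   Context: All graphs are finite and simple. $P_n$ and $K_n$ denote respectively the path and the complete graph with $n$ vertices. The subdivision graph $S(G)$ of a graph $G$ is obtained by inserting one new vertex into every edge of $G$. For graphs $G$ and $H$, with $V(G)=\{u_0,\ldots,u_{m-1}\}$, the subdivision-vertex neighbourhood corona (SVN corona) $G\boxdot H$ is the graph obtained from $S(G)$ by adding $m$ vertex-disjoint copies of $H$ (one for each $u_i$) and joining, for each $i$, every vertex of $N_{S(G)}(u_i)$ (the neighbourhood of $u_i$ in $S(G)$) to every vertex of the copy of $H$ associated with $u_i$. A $b$-chromatic coloring of a graph with $k$ colors is a proper coloring with colors $0,\ldots,k-1$ such that, for each color $i$, there is a vertex (a $b$-vertex) of color $i$ having, for each color $j\neq i$, a neighbour of color $j$. The $b$-chromatic number $\varphi(G)$ is the maximum $k$ for which $G$ has a $b$-chromatic coloring with $k$ colors. -}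

module Defs where

open import Data.Empty using (⊥; ⊥-elim-irr)
open import Data.Fin using (Fin; zero; suc; toℕ) renaming (_<_ to _<ᶠ_; _<?_ to _<ᶠ?_; _≟_ to _≟ᶠ_)
open import Data.Fin.Properties using (0↔⊥; 1↔⊤; +↔⊎; *↔×; inj⇒≟)
open import Data.Irrelevant using ([_])
open import Data.Nat using (ℕ; zero; suc; _+_; _*_; _≤_)
import Data.Nat.Properties as ℕ
open import Data.Product using (Σ-syntax; ∃-syntax; _×_; _,_; proj₁; proj₂)
open import Data.Product.Function.NonDependent.Propositional using (_×-↔_)
open import Data.Refinement using (Refinement-syntax; value; value-injective; _,_)
open import Data.Sum using (_⊎_; inj₁; inj₂; swap)
open import Data.Sum.Function.Propositional using (_⊎-↔_)
open import Data.Unit using (⊤; tt)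
open import Function using (_↔_; _∘_; Inverse; mk↔ₛ′)
open import Function.Properties.Inverse using (↔-refl; ↔-sym; ↔-trans; ↔⇒↣)
open import Level using (0ℓ)
open import Relation.Binary using (Rel; Symmetric; Irreflexive; Decidable; DecidableEquality)
open import Relation.Binary.PropositionalEquality using (_≡_; _≢_; refl; sym; subst)
open import Relation.Nullary using (¬_; yes; no; ¬?; _×-dec_; _⊎-dec_)
import Relation.Unary as U

record Graph : Set₁ where
  infix 4 _∼_
  field
    Vertex : Set
    order  : ℕ
    index  : Vertex ↔ Fin order
    _∼_    : Rel Vertex 0ℓ
    ∼-sym  : Symmetric _∼_
    ∼-irr  : Irreflexive _≡_ _∼_
    _∼?_   : Decidable _∼_

  position : Vertex → Fin order
  position = Inverse.to index

  infix 4 _≟ᵛ_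
  _≟ᵛ_ : DecidableEquality Vertex
  _≟ᵛ_ = inj⇒≟ (↔⇒↣ index)

  -- The proof in a refinement is irrelevant, and the end with the smaller
  -- position comes first, so an unordered pair of adjacent vertices is
  -- exactly one element of Edge.
  Edge : Set
  Edge = [ e ∈ Vertex × Vertex ∣ (position (proj₁ e) <ᶠ position (proj₂ e) × proj₁ e ∼ proj₂ e) ]

  infix 4 _isEndOf_
  _isEndOf_ : Vertex → Edge → Set
  v isEndOf e = v ≡ proj₁ (value e) ⊎ v ≡ proj₂ (value e)

  _isEndOf?_ : Decidable _isEndOf_
  v isEndOf? e = (v ≟ᵛ proj₁ (value e)) ⊎-dec (v ≟ᵛ proj₂ (value e))

Finite : Set → Set
Finite A = ∃[ n ] (A ↔ Fin n)

module _ {P : Fin 0 → Set} where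
  refine-Fin0 : [ i ∈ Fin 0 ∣ P i ] ↔ Fin 0
  refine-Fin0 = mk↔ₛ′ value (λ ()) (λ ()) (λ { (() , _) })

module _ {n : ℕ} {P : Fin (suc n) → Set} where
  refine-yes : P zero → [ i ∈ Fin (suc n) ∣ P i ] ↔ (⊤ ⊎ [ i ∈ Fin n ∣ P (suc i) ])
  refine-yes p = mk↔ₛ′
    (λ { (zero , _) → inj₁ tt ; (suc i , q) → inj₂ (i , q) })
    (λ { (inj₁ _) → zero , [ p ] ; (inj₂ (i , q)) → suc i , q })
    (λ { (inj₁ _) → refl ; (inj₂ _) → refl })
    (λ { (zero , _) → refl ; (suc _ , _) → refl })

  refine-no : ¬ P zero → [ i ∈ Fin (suc n) ∣ P i ] ↔ [ i ∈ Fin n ∣ P (suc i) ]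
  refine-no ¬p = mk↔ₛ′
    (λ { (zero , [ p ]) → ⊥-elim-irr (¬p p) ; (suc i , q) → i , q })
    (λ { (i , q) → suc i , q })
    (λ _ → refl)
    (λ { (zero , [ p ]) → ⊥-elim-irr (¬p p) ; (suc _ , _) → refl })

refine-Fin : ∀ n {P : Fin n → Set} → U.Decidable P → Finite [ i ∈ Fin n ∣ P i ]
refine-Fin zero    P? = 0 , refine-Fin0
refine-Fin (suc n) P? with P? zero | refine-Fin n (P? ∘ suc)
... | yes p | k , f = suc k , ↔-trans (refine-yes p) (↔-trans (↔-sym 1↔⊤ ⊎-↔ f) (↔-sym +↔⊎))
... | no ¬p | k , f = k , ↔-trans (refine-no ¬p) f

module _ {A B : Set} (f : A ↔ B) {P : A → Set} where
  open Inverse f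

  refine-↔ : [ a ∈ A ∣ P a ] ↔ [ b ∈ B ∣ P (from b) ]
  refine-↔ = mk↔ₛ′
    (λ { (a , [ p ]) → to a , [ subst P (sym (strictlyInverseʳ a)) p ] })
    (λ { (b , [ p ]) → from b , [ p ] })
    (λ { (b , _) → value-injective (strictlyInverseˡ b) })
    (λ { (a , _) → value-injective (strictlyInverseʳ a) })

refine-finite : ∀ {A} {P : A → Set} → Finite A → U.Decidable P → Finite [ a ∈ A ∣ P a ]
refine-finite (n , f) P? with refine-Fin n (P? ∘ Inverse.from f)
... | k , g = k , ↔-trans (refine-↔ f) g

⊎-finite : ∀ {A B} → Finite A → Finite B → Finite (A ⊎ B)
⊎-finite (m , f) (n , g) = m + n , ↔-trans (f ⊎-↔ g) (↔-sym +↔⊎)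

×-finite : ∀ {A B} → Finite A → Finite B → Finite (A × B)
×-finite (m , f) (n , g) = m * n , ↔-trans (f ×-↔ g) (↔-sym *↔×)

vertices-finite : (G : Graph) → Finite (Graph.Vertex G)
vertices-finite G = Graph.order G , Graph.index G

edges-finite : (G : Graph) → Finite (Graph.Edge G)
edges-finite G = refine-finite (×-finite (vertices-finite G) (vertices-finite G))
  λ (u , v) → (position u <ᶠ? position v) ×-dec (u ∼? v)
  where open Graph G

module Subdivision (G : Graph) where
  open Graph G

  SVertex : Set
  SVertex = Vertex ⊎ Edge

  infix 4 _∼ₛ_
  _∼ₛ_ : Rel SVertex 0ℓ
  inj₁ u ∼ₛ inj₁ v = ⊥
  inj₁ u ∼ₛ inj₂ e = u isEndOf e
  inj₂ e ∼ₛ inj₁ u = u isEndOf e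
  inj₂ e ∼ₛ inj₂ f = ⊥

  ∼ₛ-sym : Symmetric _∼ₛ_
  ∼ₛ-sym {inj₁ _} {inj₂ _} p = p
  ∼ₛ-sym {inj₂ _} {inj₁ _} p = p

  ∼ₛ-irr : Irreflexive _≡_ _∼ₛ_
  ∼ₛ-irr {inj₁ _} refl ()
  ∼ₛ-irr {inj₂ _} refl ()

  _∼ₛ?_ : Decidable _∼ₛ_
  inj₁ u ∼ₛ? inj₁ v = no λ ()
  inj₁ u ∼ₛ? inj₂ e = u isEndOf? e
  inj₂ e ∼ₛ? inj₁ u = u isEndOf? e
  inj₂ e ∼ₛ? inj₂ f = no λ ()

S : Graph → Graph
S G = record
  { Vertex = SVertex
  ; order  = proj₁ finite
  ; index  = proj₂ finite
  ; _∼_    = _∼ₛ_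
  ; ∼-sym  = λ {x} {y} → ∼ₛ-sym {x} {y}
  ; ∼-irr  = ∼ₛ-irr
  ; _∼?_   = _∼ₛ?_
  }
  where
  open Subdivision G
  finite : Finite SVertex
  finite = ⊎-finite (vertices-finite G) (edges-finite G)

module Corona (G H : Graph) where
  private
    module G = Graph G
    module H = Graph H
    module SG = Graph (S G)

  -- inj₂ (u , h) is the vertex h in the copy of H associated with u.
  CVertex : Set
  CVertex = SG.Vertex ⊎ (G.Vertex × H.Vertex)

  infix 4 _∼ᶜ_
  _∼ᶜ_ : Rel CVertex 0ℓ
  inj₁ x       ∼ᶜ inj₁ y       = x SG.∼ y
  inj₁ x       ∼ᶜ inj₂ (u , h) = inj₁ u SG.∼ x
  inj₂ (u , h) ∼ᶜ inj₁ x       = inj₁ u SG.∼ x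
  inj₂ (u , h) ∼ᶜ inj₂ (v , k) = u ≡ v × h H.∼ k

  ∼ᶜ-sym : Symmetric _∼ᶜ_
  ∼ᶜ-sym {inj₁ x} {inj₁ y} p       = SG.∼-sym {x} {y} p
  ∼ᶜ-sym {inj₁ _} {inj₂ _} p       = p
  ∼ᶜ-sym {inj₂ _} {inj₁ _} p       = p
  ∼ᶜ-sym {inj₂ _} {inj₂ _} (p , q) = sym p , H.∼-sym q

  ∼ᶜ-irr : Irreflexive _≡_ _∼ᶜ_
  ∼ᶜ-irr {inj₁ x} refl p       = SG.∼-irr {x} refl p
  ∼ᶜ-irr {inj₂ _} refl (_ , q) = H.∼-irr refl q

  _∼ᶜ?_ : Decidable _∼ᶜ_
  inj₁ x       ∼ᶜ? inj₁ y       = x SG.∼? y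
  inj₁ x       ∼ᶜ? inj₂ (u , h) = inj₁ u SG.∼? x
  inj₂ (u , h) ∼ᶜ? inj₁ x       = inj₁ u SG.∼? x
  inj₂ (u , h) ∼ᶜ? inj₂ (v , k) = (u G.≟ᵛ v) ×-dec (h H.∼? k)

infixl 7 _⊡_
_⊡_ : Graph → Graph → Graph
G ⊡ H = record
  { Vertex = CVertex
  ; order  = proj₁ finite
  ; index  = proj₂ finite
  ; _∼_    = _∼ᶜ_
  ; ∼-sym  = λ {x} {y} → ∼ᶜ-sym {x} {y}
  ; ∼-irr  = ∼ᶜ-irr
  ; _∼?_   = _∼ᶜ?_
  }
  where
  open Corona G H
  finite : Finite CVertex
  finite = ⊎-finite (vertices-finite (S G)) (×-finite (vertices-finite G) (vertices-finite H))

K : ℕ → Graph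
K n = record
  { Vertex = Fin n
  ; order  = n
  ; index  = ↔-refl
  ; _∼_    = _≢_
  ; ∼-sym  = λ u≢v → u≢v ∘ sym
  ; ∼-irr  = λ u≡v u≢v → u≢v u≡v
  ; _∼?_   = λ u v → ¬? (u ≟ᶠ v)
  }

P : ℕ → Graph
P n = record
  { Vertex = Fin n
  ; order  = n
  ; index  = ↔-refl
  ; _∼_    = λ u v → suc (toℕ u) ≡ toℕ v ⊎ suc (toℕ v) ≡ toℕ u
  ; ∼-sym  = swap
  ; ∼-irr  = λ { refl (inj₁ p) → ℕ.1+n≢n p ; refl (inj₂ p) → ℕ.1+n≢n p }
  ; _∼?_   = λ u v → (suc (toℕ u) ℕ.≟ toℕ v) ⊎-dec (suc (toℕ v) ℕ.≟ toℕ u)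
  }

module _ (G : Graph) where
  open Graph G

  IsProper : ∀ {k} → (Vertex → Fin k) → Set
  IsProper c = ∀ u v → u ∼ v → c u ≢ c v

  IsBVertex : ∀ {k} → (Vertex → Fin k) → Vertex → Set
  IsBVertex c v = ∀ j → j ≢ c v → ∃[ w ] (v ∼ w × c w ≡ j)

  IsBChromaticColoring : ∀ {k} → (Vertex → Fin k) → Set
  IsBChromaticColoring c = IsProper c × (∀ i → ∃[ v ] (c v ≡ i × IsBVertex c v))

  HasBChromaticColoring : ℕ → Set
  HasBChromaticColoring k = Σ[ c ∈ (Vertex → Fin k) ] IsBChromaticColoring c

  -- The proposition φ(G) = k.
  IsBChromaticNumber : ℕ → Set
  IsBChromaticNumber k = HasBChromaticColoring k × (∀ l → HasBChromaticColoring l → l ≤ k)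

{-# OPTIONS --safe #-}
module Submission where

open import Defs
open import Algebra.Bundles using (CommutativeRing)
import Algebra.Properties.CommutativeMonoid.Sum
open import Data.Bool using (Bool; true; false; _xor_; if_then_else_)
open import Data.Bool.Properties using (xor-∧-commutativeRing; xor-assoc)
open import Data.Empty using (⊥; ⊥-elim; ⊥-elim-irr)
open import Data.Fin using (Fin; zero; suc; toℕ; fromℕ<; pred; #_; punchIn; punchOut; splitAt; join; finToFun; funToFin; combine) renaming (_<_ to _<ᶠ_)
open import Data.Fin.Permutation using (permutation; _⟨$⟩ʳ_; _⟨$⟩ˡ_; inverseˡ)
open import Data.Fin.Properties using (toℕ-injective; toℕ<n; toℕ-fromℕ<; toℕ-inject₁; suc-injective; punchIn-injective; punchInᵢ≢i; punchIn-punchOut; punchOut-injective; splitAt-join; all?; any?; <-cmp; <⇒≢; injective⇒≤; pigeonhole; funToFin-finToFin; finToFun-funToFin; 2↔Bool) renaming (_≟_ to _≟ᶠ_)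
open import Data.Irrelevant using ([_])
open import Data.Nat using (ℕ; zero; suc; _+_; _∸_; _*_; _^_; _<_; _≤_; _<?_; _≤?_; s≤s; z≤n)
open import Data.Nat.DivMod using (_mod_; _%_; m%n<n; m<n⇒m%n≡m; %-distribˡ-+; n%n≡0)
import Data.Nat.Properties as ℕ
open import Data.Nat.Solver using (module +-*-Solver)
open import Data.Product using (∃-syntax; ∃₂; _×_; _,_; proj₁; proj₂)
open import Data.Refinement using (value; _,_)
open import Data.Sum using (_⊎_; inj₁; inj₂; [_,_]′; map)
open import Data.Vec using (Vec; []; _∷_; lookup)
open import Function using (_∘_; Injective; Inverse)
open import Relation.Binary using (tri<; tri≈; tri>)
open import Relation.Binary.PropositionalEquality using (_≡_; _≢_; _≗_; refl; sym; trans; cong; cong₂; subst; module ≡-Reasoning)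
open import Relation.Nullary using (Dec; yes; no; does; ¬_; ¬?; _×-dec_; _⊎-dec_; _→-dec_; contradiction)
open import Relation.Nullary.Decidable using (from-yes; map′; dec-true; dec-false)

-- Lower bounds: colour the edge vertices so that almost every vertex i of K n sees
-- pairwise distinct colours on its edges. The two or three colours left over at i then
-- fill its path, and the inner path vertices are b-vertices. Which colours are left
-- over is controlled by adding residues modulo the number of colours.
--
-- Upper bounds: a b-vertex of a colouring with l colours has degree at least l - 1, and
-- only edge vertices can have degree more than n + 1. Counting suffices except for
-- t = 3, n = 7, l = 9. There a b-vertex on the edge ij sees every other colour exactly
-- once, so in F₂⁹ the sum of all colours is its colour plus the colour sums of uᵢ and
-- uⱼ together with their copies. If instead the centre of the copy at i is a b-vertex,
-- then the colour of uᵢ recurs in that copy, so no edge at i carries a b-vertex. Hence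
-- one vector for each i (the colour of the centre in the second case, the colour sum
-- otherwise) and the sum of all colours, 8 vectors in total, would span F₂⁹.

-- Edges of the complete graph.

module _ {n : ℕ} where
  open Graph (K n) using (Edge; _isEndOf_)

  -- The inequality proof is irrelevant, so an edge depends on its two ends alone.
  edge : (i j : Fin n) → .(i ≢ j) → Edge
  edge i j i≢j with <-cmp i j
  ... | tri< i<j _ _ = (i , j) , [ i<j , i≢j ]
  ... | tri≈ _ i≡j _ = ⊥-elim-irr (i≢j i≡j)
  ... | tri> _ _ j<i = (j , i) , [ j<i , i≢j ∘ sym ]

  edge-endˡ : ∀ i j .(i≢j : i ≢ j) → i isEndOf edge i j i≢j
  edge-endˡ i j i≢j with <-cmp i j
  ... | tri< _ _ _   = inj₁ refl
  ... | tri≈ _ i≡j _ = ⊥-elim-irr (i≢j i≡j)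
  ... | tri> _ _ _   = inj₂ refl

  edge-endʳ : ∀ i j .(i≢j : i ≢ j) → j isEndOf edge i j i≢j
  edge-endʳ i j i≢j with <-cmp i j
  ... | tri< _ _ _   = inj₂ refl
  ... | tri≈ _ i≡j _ = ⊥-elim-irr (i≢j i≡j)
  ... | tri> _ _ _   = inj₁ refl

  ends-≢ : (e : Edge) → proj₁ (value e) ≢ proj₂ (value e)
  ends-≢ (_ , [ p ]) i≡j = ⊥-elim-irr (proj₂ p i≡j)

-- Colourings of the corona given by edge colours and path colours.

-- E colours the vertices inserted into the edges and q the copies of the path;
-- the vertex uᵢ of K n receives the colour of the first vertex of its path.
module Scheme {n t k : ℕ} (E : Fin n → Fin n → Fin k) (q : Fin n → Fin (suc t) → Fin k) where
  open Graph (P (suc t)) using () renaming (_∼_ to _↔ₚ_; _∼?_ to _↔ₚ?_)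

  Sees : Fin n → Fin (suc t) → Fin k → Set
  Sees i h d = (∃[ j ] (i ≢ j × E i j ≡ d)) ⊎ (∃[ h′ ] (h ↔ₚ h′ × q i h′ ≡ d))

  -- The ends of the edge are covered by `h = zero`, whose colour they share.
  EdgeSees : Fin n → Fin n → Fin k → Set
  EdgeSees i j d = (∃[ h ] q i h ≡ d) ⊎ (∃[ h ] q j h ≡ d)

  PathWitness EdgeWitness : Fin k → Set
  PathWitness c = ∃₂ λ i h → q i h ≡ c × (∀ d → d ≢ c → Sees i h d)
  EdgeWitness c = ∃₂ λ i j → i ≢ j × E i j ≡ c × (∀ d → d ≢ c → EdgeSees i j d)

  record IsBScheme : Set where
    field
      E-sym   : ∀ i j → E i j ≡ E j i
      E-q     : ∀ i j → i ≢ j → ∀ h → E i j ≢ q i h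
      q-path  : ∀ i h h′ → suc (toℕ h) ≡ toℕ h′ → q i h ≢ q i h′
      witness : ∀ c → PathWitness c ⊎ EdgeWitness c

  module _ (isBScheme : IsBScheme) where
    open IsBScheme isBScheme
    open Corona (K n) (P (suc t)) using (CVertex)
    open Graph (K n ⊡ P (suc t)) using (_∼_)
    open Graph (K n) using (_isEndOf_; Edge)

    colour : CVertex → Fin k
    colour (inj₁ (inj₁ i)) = q i zero
    colour (inj₁ (inj₂ e)) = E (proj₁ (value e)) (proj₂ (value e))
    colour (inj₂ (i , h))  = q i h

    colour-edge : ∀ i j .(i≢j : i ≢ j) → colour (inj₁ (inj₂ (edge i j i≢j))) ≡ E i j
    colour-edge i j i≢j with <-cmp i j
    ... | tri< _ _ _   = refl
    ... | tri≈ _ i≡j _ = ⊥-elim-irr (i≢j i≡j)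
    ... | tri> _ _ _   = E-sym j i

    end-≢ : ∀ i e → i isEndOf e → ∀ h → q i h ≢ colour (inj₁ (inj₂ e))
    end-≢ i e (inj₁ refl) h eq = E-q i _ (ends-≢ e) h (sym eq)
    end-≢ i e (inj₂ refl) h eq = E-q i _ (ends-≢ e ∘ sym) h (trans (E-sym i _) (sym eq))

    path-≢ : ∀ i h h′ → h ↔ₚ h′ → q i h ≢ q i h′
    path-≢ i h h′ (inj₁ p) = q-path i h h′ p
    path-≢ i h h′ (inj₂ p) = q-path i h′ h p ∘ sym

    proper : IsProper (K n ⊡ P (suc t)) colour
    proper (inj₁ (inj₁ i)) (inj₁ (inj₂ e)) p          = end-≢ i e p zero
    proper (inj₁ (inj₂ e)) (inj₁ (inj₁ i)) p          = end-≢ i e p zero ∘ sym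
    proper (inj₁ (inj₂ e)) (inj₂ (i , h))  p          = end-≢ i e p h ∘ sym
    proper (inj₂ (i , h))  (inj₁ (inj₂ e)) p          = end-≢ i e p h
    proper (inj₂ (i , h))  (inj₂ (.i , h′)) (refl , p) = path-≢ i h h′ p

    b-vertex : ∀ c → ∃[ v ] (colour v ≡ c × IsBVertex (K n ⊡ P (suc t)) colour v)
    b-vertex c with witness c
    ... | inj₁ (i , h , refl , sees) = inj₂ (i , h) , refl , λ d d≢c → neighbour d (sees d d≢c)
      where
      neighbour : ∀ d → Sees i h d → ∃[ w ] (inj₂ (i , h) ∼ w × colour w ≡ d)
      neighbour d (inj₁ (j , i≢j , refl)) = inj₁ (inj₂ (edge i j i≢j)) , edge-endˡ i j i≢j , colour-edge i j i≢j
      neighbour d (inj₂ (h′ , p , eq))    = inj₂ (i , h′) , (refl , p) , eq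
    ... | inj₂ (i , j , i≢j , refl , sees) =
      v , colour-edge i j i≢j , λ d d≢c → neighbour d (sees d (λ eq → d≢c (trans eq (sym (colour-edge i j i≢j)))))
      where
      v : CVertex
      v = inj₁ (inj₂ (edge i j i≢j))
      neighbour : ∀ d → EdgeSees i j d → ∃[ w ] (v ∼ w × colour w ≡ d)
      neighbour d (inj₁ (h , eq)) = inj₂ (i , h) , edge-endˡ i j i≢j , eq
      neighbour d (inj₂ (h , eq)) = inj₂ (j , h) , edge-endʳ i j i≢j , eq

    hasBChromaticColoring : HasBChromaticColoring (K n ⊡ P (suc t)) k
    hasBChromaticColoring = colour , proper , b-vertex

  -- The two path neighbours show their own colours, so the edges at i have to supply only the
  -- remaining ones.
  interior : ∀ i h⁻ h h⁺ → toℕ h ≡ suc (toℕ h⁻) → toℕ h⁺ ≡ suc (toℕ h) →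
    (∀ d → d ≢ q i h⁻ → d ≢ q i h → d ≢ q i h⁺ → ∃[ j ] (i ≢ j × E i j ≡ d)) → PathWitness (q i h)
  interior i h⁻ h h⁺ p p⁺ edges = i , h , refl , sees
    where
    sees : ∀ d → d ≢ q i h → Sees i h d
    sees d d≢ with d ≟ᶠ q i h⁻ | d ≟ᶠ q i h⁺
    ... | yes eq | _      = inj₂ (h⁻ , inj₂ (sym p) , sym eq)
    ... | no _   | yes eq = inj₂ (h⁺ , inj₁ (sym p⁺) , sym eq)
    ... | no d≢⁻ | no d≢⁺ = inj₁ (edges d d≢⁻ d≢ d≢⁺)

  -- Every clause ranges over finite sets, so an explicit table can be checked by evaluation.
  isBScheme? : Dec IsBScheme
  isBScheme? = map′
    (λ (s , e , p , w) → record { E-sym = s ; E-q = e ; q-path = p ; witness = w })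
    (λ b → let open IsBScheme b in E-sym , E-q , q-path , witness)
    ((all? λ i → all? λ j → E i j ≟ᶠ E j i)
    ×-dec (all? λ i → all? λ j → ¬? (i ≟ᶠ j) →-dec all? λ h → ¬? (E i j ≟ᶠ q i h))
    ×-dec (all? λ i → all? λ h → all? λ h′ → (suc (toℕ h) ℕ.≟ toℕ h′) →-dec ¬? (q i h ≟ᶠ q i h′))
    ×-dec (all? λ c →
      (any? λ i → any? λ h → (q i h ≟ᶠ c) ×-dec all? λ d → ¬? (d ≟ᶠ c) →-dec
        ((any? λ j → ¬? (i ≟ᶠ j) ×-dec (E i j ≟ᶠ d))
         ⊎-dec (any? λ h′ → (h ↔ₚ? h′) ×-dec (q i h′ ≟ᶠ d))))
      ⊎-dec (any? λ i → any? λ j → ¬? (i ≟ᶠ j) ×-dec (E i j ≟ᶠ c) ×-dec all? λ d → ¬? (d ≟ᶠ c) →-dec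
        ((any? λ h → q i h ≟ᶠ d) ⊎-dec (any? λ h → q j h ≟ᶠ d)))))

-- Explicit colourings for t = 3 and n = 2, 3, 4.

module Table {n k : ℕ} (E : Vec (Vec (Fin k) n) n) (q : Vec (Vec (Fin k) 3) n) =
  Scheme {n} {2} {k} (λ i j → lookup (lookup E i) j) (λ i h → lookup (lookup q i) h)

K₂⊡P₃ : HasBChromaticColoring (K 2 ⊡ P 3) 3
K₂⊡P₃ = hasBChromaticColoring (from-yes isBScheme?)
  where
  open Table
    ((# 0 ∷ # 0 ∷ []) ∷
     (# 0 ∷ # 0 ∷ []) ∷ [])
    ((# 1 ∷ # 2 ∷ # 1 ∷ []) ∷
     (# 1 ∷ # 2 ∷ # 1 ∷ []) ∷ [])

-- The three edges are b-vertices of colours 4, 1, 2; the centres of the paths at 0 and 2 are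
-- b-vertices of colours 3 and 0. The diagonal of the edge table holds a default value.
K₃⊡P₃ : HasBChromaticColoring (K 3 ⊡ P 3) 5
K₃⊡P₃ = hasBChromaticColoring (from-yes isBScheme?)
  where
  open Table
    ((# 0 ∷ # 4 ∷ # 1 ∷ []) ∷
     (# 4 ∷ # 0 ∷ # 2 ∷ []) ∷
     (# 1 ∷ # 2 ∷ # 0 ∷ []) ∷ [])
    ((# 0 ∷ # 3 ∷ # 2 ∷ []) ∷
     (# 0 ∷ # 1 ∷ # 0 ∷ []) ∷
     (# 4 ∷ # 0 ∷ # 3 ∷ []) ∷ [])

-- The six edges carry the six colours, and each is a b-vertex: the paths at its two ends show the
-- other five.
K₄⊡P₃ : HasBChromaticColoring (K 4 ⊡ P 3) 6
K₄⊡P₃ = hasBChromaticColoring (from-yes isBScheme?)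
  where
  open Table
    ((# 0 ∷ # 0 ∷ # 4 ∷ # 5 ∷ []) ∷
     (# 0 ∷ # 0 ∷ # 1 ∷ # 3 ∷ []) ∷
     (# 4 ∷ # 1 ∷ # 0 ∷ # 2 ∷ []) ∷
     (# 5 ∷ # 3 ∷ # 2 ∷ # 0 ∷ []) ∷ [])
    ((# 3 ∷ # 1 ∷ # 2 ∷ []) ∷
     (# 2 ∷ # 4 ∷ # 5 ∷ []) ∷
     (# 5 ∷ # 3 ∷ # 0 ∷ []) ∷
     (# 1 ∷ # 4 ∷ # 0 ∷ []) ∷ [])

-- Periodic colour sequences and arithmetic modulo N.

module _ {A : Set} where
  cyc : A → A → A → ℕ → A
  cyc a b c zero    = a
  cyc a b c (suc m) = cyc b c a m

  cyc-adjacent : ∀ {a b c} → a ≢ b → b ≢ c → c ≢ a → ∀ m → cyc a b c m ≢ cyc a b c (suc m)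
  cyc-adjacent a≢b b≢c c≢a zero    = a≢b
  cyc-adjacent a≢b b≢c c≢a (suc m) = cyc-adjacent b≢c c≢a a≢b m

  cyc-elim : ∀ {a b c} (Q : A → Set) → Q a → Q b → Q c → ∀ m → Q (cyc a b c m)
  cyc-elim Q a b c zero    = a
  cyc-elim Q a b c (suc m) = cyc-elim Q b c a m

-- Enumerates everything except p and q: `punchOut p≢q` is the place of q once p is removed.
punchIn₂ : ∀ {n} {p q : Fin (suc (suc n))} → p ≢ q → Fin n → Fin (suc (suc n))
punchIn₂ {p = p} p≢q i = punchIn p (punchIn (punchOut p≢q) i)

module _ {n : ℕ} {p q : Fin (suc (suc n))} (p≢q : p ≢ q) where
  punchIn₂-injective : ∀ {i j} → punchIn₂ p≢q i ≡ punchIn₂ p≢q j → i ≡ j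
  punchIn₂-injective = punchIn-injective (punchOut p≢q) _ _ ∘ punchIn-injective p _ _

  punchIn₂≢ˡ : ∀ i → punchIn₂ p≢q i ≢ p
  punchIn₂≢ˡ i = punchInᵢ≢i p _

  punchIn₂≢ʳ : ∀ i → punchIn₂ p≢q i ≢ q
  punchIn₂≢ʳ i eq = punchInᵢ≢i (punchOut p≢q) i (punchIn-injective p _ _ (trans eq (sym (punchIn-punchOut p≢q))))

  punchIn₂-onto : ∀ {x} → x ≢ p → x ≢ q → ∃[ i ] punchIn₂ p≢q i ≡ x
  punchIn₂-onto {x} x≢p x≢q = punchOut q≢ , trans (cong (punchIn p) (punchIn-punchOut q≢)) (punchIn-punchOut p≢x)
    where
    p≢x : p ≢ x
    p≢x = x≢p ∘ sym
    q≢ : punchOut p≢q ≢ punchOut p≢x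
    q≢ eq = x≢q (trans (sym (punchIn-punchOut p≢x)) (trans (cong (punchIn p) (sym eq)) (punchIn-punchOut p≢q)))

module ℤmod (N-1 : ℕ) where
  N : ℕ
  N = suc N-1

  residue : ℕ → Fin N
  residue m = m mod N

  infixl 6 _⊕_
  _⊕_ : Fin N → Fin N → Fin N
  x ⊕ y = residue (toℕ x + toℕ y)

  toℕ-residue : ∀ m → toℕ (residue m) ≡ m % N
  toℕ-residue m = toℕ-fromℕ< (m%n<n m N)

  residue-toℕ : ∀ x → residue (toℕ x) ≡ x
  residue-toℕ x = toℕ-injective (trans (toℕ-residue (toℕ x)) (m<n⇒m%n≡m (toℕ<n x)))

  -- Reduction modulo N is additive, which lets the group laws be inherited from ℕ.
  residue-+ : ∀ a b → residue a ⊕ residue b ≡ residue (a + b)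
  residue-+ a b = toℕ-injective (begin
    toℕ (residue a ⊕ residue b)             ≡⟨ toℕ-residue (toℕ (residue a) + toℕ (residue b)) ⟩
    (toℕ (residue a) + toℕ (residue b)) % N ≡⟨ cong₂ (λ x y → (x + y) % N) (toℕ-residue a) (toℕ-residue b) ⟩
    (a % N + b % N) % N                     ≡⟨ %-distribˡ-+ a b N ⟨
    (a + b) % N                             ≡⟨ toℕ-residue (a + b) ⟨
    toℕ (residue (a + b))                   ∎)
    where open ≡-Reasoning

  ⊕-comm : ∀ x y → x ⊕ y ≡ y ⊕ x
  ⊕-comm x y = cong residue (ℕ.+-comm (toℕ x) (toℕ y))

  ⊕-assoc : ∀ x y z → (x ⊕ y) ⊕ z ≡ x ⊕ (y ⊕ z)
  ⊕-assoc x y z = begin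
    (x ⊕ y) ⊕ z                                         ≡⟨ cong ((x ⊕ y) ⊕_) (residue-toℕ z) ⟨
    residue (toℕ x + toℕ y) ⊕ residue (toℕ z)           ≡⟨ residue-+ (toℕ x + toℕ y) (toℕ z) ⟩
    residue (toℕ x + toℕ y + toℕ z)                     ≡⟨ cong residue (ℕ.+-assoc (toℕ x) (toℕ y) (toℕ z)) ⟩
    residue (toℕ x + (toℕ y + toℕ z))                   ≡⟨ residue-+ (toℕ x) (toℕ y + toℕ z) ⟨
    residue (toℕ x) ⊕ (y ⊕ z)                           ≡⟨ cong (_⊕ (y ⊕ z)) (residue-toℕ x) ⟩
    x ⊕ (y ⊕ z)                                         ∎
    where open ≡-Reasoning

  ⊕-identityˡ : ∀ x → zero ⊕ x ≡ x
  ⊕-identityˡ = residue-toℕ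

  ⊕-identityʳ : ∀ x → x ⊕ zero ≡ x
  ⊕-identityʳ x = trans (⊕-comm x zero) (⊕-identityˡ x)

  ⊖_ : Fin N → Fin N
  ⊖ x = residue (N ∸ toℕ x)

  ⊕-inverseʳ : ∀ x → x ⊕ ⊖ x ≡ zero
  ⊕-inverseʳ x = begin
    x ⊕ ⊖ x                      ≡⟨ cong (_⊕ ⊖ x) (residue-toℕ x) ⟨
    residue (toℕ x) ⊕ ⊖ x        ≡⟨ residue-+ (toℕ x) (N ∸ toℕ x) ⟩
    residue (toℕ x + (N ∸ toℕ x)) ≡⟨ cong residue (ℕ.m+[n∸m]≡n (ℕ.<⇒≤ (toℕ<n x))) ⟩
    residue N                    ≡⟨ toℕ-injective (trans (toℕ-residue N) (n%n≡0 N)) ⟩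
    zero                         ∎
    where open ≡-Reasoning

  ⊕-inverseˡ : ∀ x → ⊖ x ⊕ x ≡ zero
  ⊕-inverseˡ x = trans (⊕-comm (⊖ x) x) (⊕-inverseʳ x)

  _⊝_ : Fin N → Fin N → Fin N
  d ⊝ x = ⊖ x ⊕ d

  ⊝-≡ : ∀ x {y d} → d ⊝ x ≡ y → d ≡ x ⊕ y
  ⊝-≡ x {_} {d} refl = sym (trans (sym (⊕-assoc x (⊖ x) d)) (trans (cong (_⊕ d) (⊕-inverseʳ x)) (⊕-identityˡ d)))

  ⊕-cancelˡ : ∀ x {y z} → x ⊕ y ≡ x ⊕ z → y ≡ z
  ⊕-cancelˡ x {y} {z} eq = trans (sym (drop y)) (trans (cong (⊖ x ⊕_) eq) (drop z))
    where
    drop : ∀ w → ⊖ x ⊕ (x ⊕ w) ≡ w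
    drop w = trans (sym (⊕-assoc (⊖ x) x w)) (trans (cong (_⊕ w) (⊕-inverseˡ x)) (⊕-identityˡ w))

  x⊕y≡x⇒y≡0 : ∀ x {y} → x ⊕ y ≡ x → y ≡ zero
  x⊕y≡x⇒y≡0 x eq = ⊕-cancelˡ x (trans eq (sym (⊕-identityʳ x)))

-- Lower bound for n = 2 and t > 3.

module K₂⊡P (t : ℕ) where
  private
    q : Fin 2 → Fin (4 + t) → Fin 4
    q zero       h = cyc (# 1) (# 2) (# 3) (toℕ h)
    q (suc zero) h = cyc (# 3) (# 1) (# 2) (toℕ h)
  open Scheme {2} {3 + t} {4} (λ _ _ → zero) q

  private
    zero≢q : ∀ j h → zero ≢ q j h
    zero≢q zero       h = cyc-elim (zero ≢_) (λ ()) (λ ()) (λ ()) (toℕ h)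
    zero≢q (suc zero) h = cyc-elim (zero ≢_) (λ ()) (λ ()) (λ ()) (toℕ h)

    path : ∀ i h h′ → suc (toℕ h) ≡ toℕ h′ → q i h ≢ q i h′
    path zero       h h′ eq rewrite sym eq = cyc-adjacent (λ ()) (λ ()) (λ ()) (toℕ h)
    path (suc zero) h h′ eq rewrite sym eq = cyc-adjacent (λ ()) (λ ()) (λ ()) (toℕ h)

    -- The edge sees 1, 2, 3 on a path. Each path repeats these three colours periodically, so any
    -- inner path vertex sees the other two beside it and 0 on the edge.
    witness : ∀ c → PathWitness c ⊎ EdgeWitness c
    witness zero = inj₂ (# 0 , # 1 , (λ ()) , refl , λ where
      zero d≢                → contradiction refl d≢
      (suc zero) _           → inj₁ (# 0 , refl)
      (suc (suc zero)) _     → inj₁ (# 1 , refl)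
      (suc (suc (suc zero))) _ → inj₁ (# 2 , refl))
    witness (suc zero) = inj₁ (interior (# 1) (# 0) (# 1) (# 2) refl refl λ where
      zero _ _ _                      → # 0 , (λ ()) , refl
      (suc zero) _ d≢ _               → contradiction refl d≢
      (suc (suc zero)) _ _ d≢         → contradiction refl d≢
      (suc (suc (suc zero))) d≢ _ _   → contradiction refl d≢)
    witness (suc (suc zero)) = inj₁ (interior (# 0) (# 0) (# 1) (# 2) refl refl λ where
      zero _ _ _                      → # 1 , (λ ()) , refl
      (suc zero) d≢ _ _               → contradiction refl d≢
      (suc (suc zero)) _ d≢ _         → contradiction refl d≢
      (suc (suc (suc zero))) _ _ d≢   → contradiction refl d≢)
    -- Position 2 is inner because the path has at least four vertices.
    witness (suc (suc (suc zero))) = inj₁ (interior (# 0) (# 1) (# 2) (# 3) refl refl λ where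
      zero _ _ _                      → # 1 , (λ ()) , refl
      (suc zero) _ _ d≢               → contradiction refl d≢
      (suc (suc zero)) d≢ _ _         → contradiction refl d≢
      (suc (suc (suc zero))) _ d≢ _   → contradiction refl d≢)

  four-colouring : HasBChromaticColoring (K 2 ⊡ P (4 + t)) 4
  four-colouring = hasBChromaticColoring record
    { E-sym = λ _ _ → refl ; E-q = λ i j _ → zero≢q i ; q-path = path ; witness = witness }

-- Lower bound for n ≥ 3 and t > 3.

-- The vertices of K n are the residues x ≠ 0, 2 modulo n + 2, and xy has colour
-- x + y. The colours missing at x are then x, x + 2 and 2x, and they colour its path.
module LongPath (n′ t : ℕ) where
  private
    n N : ℕ
    n = 3 + n′
    N = 2 + n
  open ℤmod (1 + n)  hiding (N)
  private
    1# 2# -1# -2# : Fin N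
    1# = # 1
    2# = # 2
    -1# = ⊖ 1#
    -2# = ⊖ 2#

    0≢2 : zero ≢ 2#
    0≢2 ()

    ℓ : Fin n → Fin N
    ℓ = punchIn₂ 0≢2

    -- The second and third vertices of a path are b-vertices. Usually they have the
    -- colours x and x + 2, but the colour 2 only arises as 2x with x = 1.
    path : Fin N → ℕ → Fin N
    path x with x ≟ᶠ 1#
    ... | yes _ = cyc x (x ⊕ x) (x ⊕ 2#)
    ... | no  _ = cyc (x ⊕ x) x (x ⊕ 2#)

    module _ {x : Fin N} (x≢0 : x ≢ zero) (x≢2 : x ≢ 2#) where
      x≢x⊕x : x ≢ x ⊕ x
      x≢x⊕x eq = x≢0 (x⊕y≡x⇒y≡0 x (sym eq))

      x≢x⊕2 : x ≢ x ⊕ 2#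
      x≢x⊕2 eq = 0≢2 (sym (x⊕y≡x⇒y≡0 x (sym eq)))

      x⊕x≢x⊕2 : x ⊕ x ≢ x ⊕ 2#
      x⊕x≢x⊕2 eq = x≢2 (⊕-cancelˡ x eq)

      path-adjacent : ∀ m → path x m ≢ path x (suc m)
      path-adjacent with x ≟ᶠ 1#
      ... | yes _ = cyc-adjacent x≢x⊕x x⊕x≢x⊕2 (x≢x⊕2 ∘ sym)
      ... | no  _ = cyc-adjacent (x≢x⊕x ∘ sym) x≢x⊕2 (x⊕x≢x⊕2 ∘ sym)

      x⊕y≢path : ∀ {y} → y ≢ zero → y ≢ 2# → x ≢ y → ∀ m → x ⊕ y ≢ path x m
      x⊕y≢path {y} y≢0 y≢2 x≢y with x ≟ᶠ 1#
      ... | yes _ = cyc-elim (x ⊕ y ≢_) (y≢0 ∘ x⊕y≡x⇒y≡0 x) (x≢y ∘ sym ∘ ⊕-cancelˡ x) (y≢2 ∘ ⊕-cancelˡ x)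
      ... | no  _ = cyc-elim (x ⊕ y ≢_) (x≢y ∘ sym ∘ ⊕-cancelˡ x) (y≢0 ∘ x⊕y≡x⇒y≡0 x) (y≢2 ∘ ⊕-cancelˡ x)

    E : Fin n → Fin n → Fin N
    E i j = ℓ i ⊕ ℓ j

    q : Fin n → Fin (4 + t) → Fin N
    q i h = path (ℓ i) (toℕ h)

  open Scheme E q

  private
    vertex : ∀ {x} → x ≢ zero → x ≢ 2# → ∃[ i ] ℓ i ≡ x
    vertex = punchIn₂-onto 0≢2

    -- The other end is y = d - x, where x is `ℓ i`. The three inequalities say that y is neither 0
    -- nor x nor 2, so it is another vertex of K n.
    edges : ∀ i d → d ≢ ℓ i → d ≢ ℓ i ⊕ ℓ i → d ≢ ℓ i ⊕ 2# → ∃[ j ] (i ≢ j × E i j ≡ d)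
    edges i d d≢x d≢2x d≢x+2 = j , (λ i≡j → d≢2x (⊝-≡ (ℓ i) (trans (sym ℓj≡) (cong ℓ (sym i≡j))))) , sym (⊝-≡ (ℓ i) (sym ℓj≡))
      where
      preimage : ∃[ j ] ℓ j ≡ d ⊝ ℓ i
      preimage = vertex (λ eq → d≢x (trans (⊝-≡ (ℓ i) eq) (⊕-identityʳ (ℓ i)))) (d≢x+2 ∘ ⊝-≡ (ℓ i))
      j   = proj₁ preimage
      ℓj≡ = proj₂ preimage

    -- Here and below, adding 1 or 2 to both sides equates 0 with one of 1, 2, 3, 4, which is false
    -- since N ≥ 5.
    -1≢0 : -1# ≢ zero
    -1≢0 eq with () ← trans (sym (⊕-inverseʳ 1#)) (trans (cong (1# ⊕_) eq) (⊕-identityʳ 1#))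

    -1≢1 : -1# ≢ 1#
    -1≢1 eq with () ← trans (sym (⊕-inverseʳ 1#)) (cong (1# ⊕_) eq)

    -1≢2 : -1# ≢ 2#
    -1≢2 eq with () ← trans (sym (⊕-inverseʳ 1#)) (cong (1# ⊕_) eq)

    -2≢0 : -2# ≢ zero
    -2≢0 eq with () ← trans (sym (⊕-inverseʳ 2#)) (trans (cong (2# ⊕_) eq) (⊕-identityʳ 2#))

    -2≢1 : -2# ≢ 1#
    -2≢1 eq with () ← trans (sym (⊕-inverseʳ 2#)) (cong (2# ⊕_) eq)

    -2≢2 : -2# ≢ 2#
    -2≢2 eq with () ← trans (sym (⊕-inverseʳ 2#)) (cong (2# ⊕_) eq)

    -- For x other than 1 the path runs 2x, x, x + 2, 2x, so x and x + 2 stand at the inner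
    -- positions 1 and 2.
    at-x : ∀ {x} → x ≢ zero → x ≢ 1# → x ≢ 2# → PathWitness x
    at-x {x} x≢0 x≢1 x≢2 with vertex x≢0 x≢2
    ... | i , refl with interior i (# 0) (# 1) (# 2) refl refl
    ... | w with ℓ i ≟ᶠ 1#
    ... | yes eq = contradiction eq x≢1
    ... | no  _  = w λ d p q r → edges i d q p r

    at-x⊕2 : ∀ {x} → x ≢ zero → x ≢ 1# → x ≢ 2# → PathWitness (x ⊕ 2#)
    at-x⊕2 {x} x≢0 x≢1 x≢2 with vertex x≢0 x≢2
    ... | i , refl with interior i (# 1) (# 2) (# 3) refl refl
    ... | w with ℓ i ≟ᶠ 1#
    ... | yes eq = contradiction eq x≢1
    ... | no  _  = w λ d p q r → edges i d p r q

    at-1⊕1 : PathWitness 2#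
    at-1⊕1 with vertex {1#} (λ ()) (λ ())
    ... | i , ℓi≡1 with interior i (# 0) (# 1) (# 2) refl refl
    ... | w with ℓ i ≟ᶠ 1#
    ... | yes _  = subst PathWitness (cong₂ _⊕_ ℓi≡1 ℓi≡1) (w λ d → edges i d)
    ... | no ℓi≢1 = contradiction ℓi≡1 ℓi≢1

    -- No vertex is 0 or 2, and the path at 1 has its own order. So 0 and 1 are reached as -2 + 2
    -- and -1 + 2, and 2 as 1 + 1; every other colour occurs at the vertex of the same name.
    witness : ∀ c → PathWitness c
    witness c with c ≟ᶠ zero | c ≟ᶠ 1# | c ≟ᶠ 2#
    ... | yes refl | _        | _        = subst PathWitness (⊕-inverseˡ 2#) (at-x⊕2 -2≢0 -2≢1 -2≢2)
    ... | no _     | yes refl | _        = subst PathWitness -1⊕2≡1 (at-x⊕2 -1≢0 -1≢1 -1≢2)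
      where
      -1⊕2≡1 : -1# ⊕ 2# ≡ 1#
      -1⊕2≡1 = trans (sym (⊕-assoc -1# 1# 1#)) (cong (_⊕ 1#) (⊕-inverseˡ 1#))
    ... | no _     | no _     | yes refl = at-1⊕1
    ... | no c≢0   | no c≢1   | no c≢2   = at-x c≢0 c≢1 c≢2

  n+2-colouring : HasBChromaticColoring (K n ⊡ P (4 + t)) N
  n+2-colouring = hasBChromaticColoring record
    { E-sym   = λ i j → ⊕-comm (ℓ i) (ℓ j)
    ; E-q     = λ i j i≢j h → x⊕y≢path (punchIn₂≢ˡ 0≢2 i) (punchIn₂≢ʳ 0≢2 i)
                  (punchIn₂≢ˡ 0≢2 j) (punchIn₂≢ʳ 0≢2 j) (i≢j ∘ punchIn₂-injective 0≢2) (toℕ h)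
    ; q-path  = λ i h h′ p → subst (λ m → q i h ≢ path (ℓ i) m) p
                  (path-adjacent (punchIn₂≢ˡ 0≢2 i) (punchIn₂≢ʳ 0≢2 i) (toℕ h))
    ; witness = λ c → inj₁ (witness c)
    }

-- Lower bound for n ≥ 7 and t = 3.

-- The vertices of K n are the residues x ≠ 0 modulo n + 1, and xy has colour x + y,
-- except that the edge between 2 and -2 has colour -4 rather than 0. The colours
-- missing at x are then x and 2x, except that those missing at -2 are -2 and 0. The
-- path at 2 is coloured by 2 and 0 but its vertices need not be b-vertices, as the
-- colour 2 is also missing at 1.
module ThreeVertexPath (n′ : ℕ) where
  private
    n N : ℕ
    n = 7 + n′
    N = 1 + n
  open ℤmod n hiding (N)
  private
    1# 2# -2# : Fin N
    1# = # 1
    2# = # 2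
    -2# = ⊖ 2#

    Special : Fin N → Fin N → Set
    Special x y = (x ≡ 2# × y ≡ -2#) ⊎ (x ≡ -2# × y ≡ 2#)

    special? : ∀ x y → Dec (Special x y)
    special? x y = ((x ≟ᶠ 2#) ×-dec (y ≟ᶠ -2#)) ⊎-dec ((x ≟ᶠ -2#) ×-dec (y ≟ᶠ 2#))

    special-sym : ∀ {x y} → Special x y → Special y x
    special-sym (inj₁ (p , q)) = inj₂ (q , p)
    special-sym (inj₂ (p , q)) = inj₁ (q , p)

    -- With x + y throughout, 0 would be missing only where 2x = 0, which a nonzero x satisfies only
    -- for even N. The exceptional edge makes 0 missing at -2 in place of -4.
    edge-colour : Fin N → Fin N → Fin N
    edge-colour x y with special? x y
    ... | yes _ = -2# ⊕ -2#
    ... | no  _ = x ⊕ y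

    edge-colour-special : ∀ {x y} → Special x y → edge-colour x y ≡ -2# ⊕ -2#
    edge-colour-special {x} {y} s with special? x y
    ... | yes _ = refl
    ... | no ¬s = contradiction s ¬s

    edge-colour-⊕ : ∀ {x y} → ¬ Special x y → edge-colour x y ≡ x ⊕ y
    edge-colour-⊕ {x} {y} ¬s with special? x y
    ... | yes s = contradiction s ¬s
    ... | no _  = refl

    edge-colour-sym : ∀ x y → edge-colour x y ≡ edge-colour y x
    edge-colour-sym x y with special? x y
    ... | yes s = sym (edge-colour-special (special-sym s))
    ... | no ¬s = trans (⊕-comm x y) (sym (edge-colour-⊕ (¬s ∘ special-sym)))

    second : Fin N → Fin N
    second x with x ≟ᶠ 2# | x ≟ᶠ -2#
    ... | no _  | no _  = x ⊕ x
    ... | _     | _     = zero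

    second-double : ∀ {x} → x ≢ 2# → x ≢ -2# → second x ≡ x ⊕ x
    second-double {x} x≢2 x≢-2 with x ≟ᶠ 2# | x ≟ᶠ -2#
    ... | no _  | no _  = refl
    ... | yes p | _     = contradiction p x≢2
    ... | no _  | yes p = contradiction p x≢-2

    second-zero : ∀ {x} → x ≡ 2# ⊎ x ≡ -2# → second x ≡ zero
    second-zero {x} p with x ≟ᶠ 2# | x ≟ᶠ -2#
    second-zero p        | yes _  | _      = refl
    second-zero p        | no _   | yes _  = refl
    second-zero (inj₁ p) | no ¬p  | no _   = contradiction p ¬p
    second-zero (inj₂ p) | no _   | no ¬p  = contradiction p ¬p

    x⊕y≡0⇒y≡⊖x : ∀ x {y} → x ⊕ y ≡ zero → y ≡ ⊖ x
    x⊕y≡0⇒y≡⊖x x eq = ⊕-cancelˡ x (trans eq (sym (⊕-inverseʳ x)))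

    -2≢ : ∀ {m} → 2# ⊕ m ≢ zero → -2# ≢ m
    -2≢ 2+m≢0 refl = 2+m≢0 (⊕-inverseʳ 2#)

    -2≢0 : -2# ≢ zero
    -2≢0 = -2≢ (λ ())

    -2≢2 : -2# ≢ 2#
    -2≢2 = -2≢ (λ ())

    -4≢0 : -2# ⊕ -2# ≢ zero
    -4≢0 eq = -2≢2 (sym (⊕-cancelˡ -2# (trans (⊕-inverseˡ 2#) (sym eq))))

    -4≢-2 : -2# ⊕ -2# ≢ -2#
    -4≢-2 = -2≢0 ∘ x⊕y≡x⇒y≡0 -2#

    -4≢2 : -2# ⊕ -2# ≢ 2#
    -- From -4 = 2 follows -2 = 4, hence 6 = 0, but N ≥ 8.
    -4≢2 eq = -2≢ {# 4} (λ ()) (begin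
      -2#               ≡⟨ ⊕-identityˡ -2# ⟨
      zero ⊕ -2#        ≡⟨ cong (_⊕ -2#) (⊕-inverseʳ 2#) ⟨
      (2# ⊕ -2#) ⊕ -2#  ≡⟨ ⊕-assoc 2# -2# -2# ⟩
      2# ⊕ (-2# ⊕ -2#)  ≡⟨ cong (2# ⊕_) eq ⟩
      # 4               ∎)
      where open ≡-Reasoning

    first≢second : ∀ x → x ≢ zero → x ≢ second x
    first≢second x x≢0 with x ≟ᶠ 2# | x ≟ᶠ -2#
    ... | no _  | no _  = λ eq → x≢0 (x⊕y≡x⇒y≡0 x (sym eq))
    ... | yes _ | _     = x≢0
    ... | no _  | yes _ = x≢0

    edge≢first : ∀ {x y} → x ≢ zero → y ≢ zero → edge-colour x y ≢ x
    edge≢first {x} {y} x≢0 y≢0 eq with special? x y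
    ... | yes (inj₁ (refl , _)) = -4≢2 eq
    ... | yes (inj₂ (refl , _)) = -4≢-2 eq
    ... | no _                  = y≢0 (x⊕y≡x⇒y≡0 x eq)

    -- At 2 and -2 the second colour is 0, and only the exceptional edge has x + y = 0 there;
    -- elsewhere x + y = 2x forces x = y.
    edge≢second : ∀ {x y} → x ≢ y → edge-colour x y ≢ second x
    edge≢second {x} {y} x≢y eq = by-cases (special? x y) (x ≟ᶠ 2#) (x ≟ᶠ -2#)
      where
      by-cases : Dec (Special x y) → Dec (x ≡ 2#) → Dec (x ≡ -2#) → ⊥
      by-cases (yes s) _ _ = -4≢0 (trans (sym (edge-colour-special s)) (trans eq (second-zero (map proj₁ proj₁ s))))
      by-cases (no ¬s) (yes x≡2) _ = ¬s (inj₁ (x≡2 , trans (x⊕y≡0⇒y≡⊖x x x⊕y≡0) (cong ⊖_ x≡2)))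
        where
        x⊕y≡0 : x ⊕ y ≡ zero
        x⊕y≡0 = trans (sym (edge-colour-⊕ ¬s)) (trans eq (second-zero (inj₁ x≡2)))
      by-cases (no ¬s) (no _) (yes x≡-2) = ¬s (inj₂ (x≡-2 , ⊕-cancelˡ x (trans x⊕y≡0 (sym x⊕2≡0))))
        where
        x⊕y≡0 : x ⊕ y ≡ zero
        x⊕y≡0 = trans (sym (edge-colour-⊕ ¬s)) (trans eq (second-zero (inj₂ x≡-2)))
        x⊕2≡0 : x ⊕ 2# ≡ zero
        x⊕2≡0 = trans (cong (_⊕ 2#) x≡-2) (⊕-inverseˡ 2#)
      by-cases (no ¬s) (no x≢2) (no x≢-2) =
        x≢y (sym (⊕-cancelˡ x (trans (sym (edge-colour-⊕ ¬s)) (trans eq (second-double x≢2 x≢-2)))))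

    -- Usually y = d - x. At x = -2 the colour d = -4 comes from the exceptional edge instead. The
    -- vertex 2 is left out because 4 may be missing there too.
    neighbour : ∀ x d → x ≢ 2# → d ≢ x → d ≢ second x → ∃[ y ] (y ≢ zero × x ≢ y × edge-colour x y ≡ d)
    neighbour x d x≢2 d≢x d≢second = by-cases (x ≟ᶠ -2#) (d ≟ᶠ x ⊕ x)
      where
      by-difference : d ≢ x ⊕ x → ¬ Special x (d ⊝ x) → ∃[ y ] (y ≢ zero × x ≢ y × edge-colour x y ≡ d)
      by-difference d≢2x ¬s = d ⊝ x
        , (λ eq → d≢x (trans (⊝-≡ x eq) (⊕-identityʳ x)))
        , (λ eq → d≢2x (⊝-≡ x (sym eq)))
        , trans (edge-colour-⊕ ¬s) (sym (⊝-≡ x refl))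

      by-cases : Dec (x ≡ -2#) → Dec (d ≡ x ⊕ x) → ∃[ y ] (y ≢ zero × x ≢ y × edge-colour x y ≡ d)
      by-cases (yes x≡-2) (yes d≡2x) =
        2# , (λ ()) , x≢2 , trans (edge-colour-special (inj₂ (x≡-2 , refl))) (sym (trans d≡2x (cong₂ _⊕_ x≡-2 x≡-2)))
      by-cases (yes x≡-2) (no d≢2x)  = by-difference d≢2x λ where
        (inj₁ (x≡2 , _)) → x≢2 x≡2
        (inj₂ (_ , y≡2)) → d≢second (trans (⊝-≡ x y≡2)
          (trans (cong (_⊕ 2#) x≡-2) (trans (⊕-inverseˡ 2#) (sym (second-zero (inj₂ x≡-2))))))
      by-cases (no x≢-2) _ = by-difference (λ d≡2x → d≢second (trans d≡2x (sym (second-double x≢2 x≢-2)))) λ where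
        (inj₁ (x≡2 , _))  → x≢2 x≡2
        (inj₂ (x≡-2 , _)) → x≢-2 x≡-2

    E : Fin n → Fin n → Fin N
    E i j = edge-colour (suc i) (suc j)

    q : Fin n → Fin 3 → Fin N
    q i zero             = suc i
    q i (suc zero)       = second (suc i)
    q i (suc (suc zero)) = suc i

  open Scheme E q

  private
    edges : ∀ i d → suc i ≢ 2# → d ≢ suc i → d ≢ second (suc i) → ∃[ j ] (i ≢ j × E i j ≡ d)
    edges i d i≢2 d≢ d≢′ with neighbour (suc i) d i≢2 d≢ d≢′
    ... | zero  , y≢0 , _   , _  = contradiction refl y≢0
    ... | suc j , _   , i≢j , eq = j , i≢j ∘ cong suc , eq

    -- Only two colours are missing at x, so an end of the path is already a b-vertex.
    first-witness : ∀ i → suc i ≢ 2# → PathWitness (suc i)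
    first-witness i i≢2 = i , zero , refl , sees
      where
      sees : ∀ d → d ≢ suc i → Sees i zero d
      sees d d≢ with d ≟ᶠ second (suc i)
      ... | yes eq = inj₂ (suc zero , inj₁ refl , sym eq)
      ... | no d≢′ = inj₁ (edges i d i≢2 d≢ d≢′)

    second-witness : ∀ x → x ≢ zero → x ≢ 2# → PathWitness (second x)
    second-witness zero    x≢0 _   = contradiction refl x≢0
    second-witness (suc i) _   i≢2 =
      interior i zero (suc zero) (suc (suc zero)) refl refl λ d d≢ d≢′ _ → edges i d i≢2 d≢ d≢′

    -- The colours 0 and 2 stand at the centres of the paths at -2 and 1.
    witness : ∀ c → PathWitness c
    witness zero    = subst PathWitness (second-zero { -2# } (inj₂ refl)) (second-witness -2# -2≢0 -2≢2)
    witness (suc i) with suc i ≟ᶠ 2#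
    ... | no i≢2   = first-witness i i≢2
    ... | yes i≡2  = subst PathWitness (trans (second-double {1#} (λ ()) (-2≢ {1#} (λ ()) ∘ sym)) (sym i≡2)) (second-witness 1# (λ ()) (λ ()))

  n+1-colouring : HasBChromaticColoring (K n ⊡ P 3) N
  n+1-colouring = hasBChromaticColoring record
    { E-sym   = λ i j → edge-colour-sym (suc i) (suc j)
    ; E-q     = E-q
    ; q-path  = q-path
    ; witness = λ c → inj₁ (witness c)
    }
    where
    E-q : ∀ i j → i ≢ j → ∀ h → E i j ≢ q i h
    E-q i j i≢j zero             = edge≢first (λ ()) (λ ())
    E-q i j i≢j (suc zero)       = edge≢second (i≢j ∘ suc-injective)
    E-q i j i≢j (suc (suc zero)) = edge≢first (λ ()) (λ ())
    q-path : ∀ i h h′ → suc (toℕ h) ≡ toℕ h′ → q i h ≢ q i h′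
    q-path i zero       (suc zero)       _ = first≢second (suc i) (λ ())
    q-path i (suc zero) (suc (suc zero)) _ = first≢second (suc i) (λ ()) ∘ sym

-- Finite surjections, counting of bit vectors, and sums over F₂.

module _ {m l : ℕ} {f : Fin m → Fin l} (onto : ∀ y → ∃[ x ] f x ≡ y) where
  section-injective : Injective _≡_ _≡_ (proj₁ ∘ onto)
  section-injective {y} {y′} eq = trans (sym (proj₂ (onto y))) (trans (cong f eq) (proj₂ (onto y′)))

  onto⇒≤ : l ≤ m
  onto⇒≤ = injective⇒≤ section-injective

-- Punching out a missed value would inject `Fin (suc m)` into `Fin m`.
injective⇒onto : ∀ {m} {f : Fin m → Fin m} → Injective _≡_ _≡_ f → ∀ y → ∃[ x ] f x ≡ y
injective⇒onto {suc m} {f} inj y with any? (λ x → f x ≟ᶠ y)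
... | yes hit = hit
... | no miss = contradiction (injective⇒≤ (inj ∘ punchOut-injective (avoid _) (avoid _))) ℕ.1+n≰n
  where
  avoid : ∀ x → y ≢ f x
  avoid x eq = miss (x , sym eq)

-- The section of f is injective, hence onto, and so a two-sided inverse.
onto⇒permutation : ∀ {m} {f : Fin m → Fin m} (onto : ∀ y → ∃[ x ] f x ≡ y) → ∃[ π ] (∀ x → π ⟨$⟩ʳ x ≡ f x)
onto⇒permutation {m} {f} onto = permutation f (proj₁ ∘ onto) ((proj₂ ∘ onto)) section∘f , λ _ → refl
  where
  section∘f : ∀ x → proj₁ (onto (f x)) ≡ x
  section∘f x with injective⇒onto (section-injective onto) x
  ... | y , refl = cong (proj₁ ∘ onto) (proj₂ (onto y))

onto⇒injective : ∀ {m} {f : Fin m → Fin m} → (∀ y → ∃[ x ] f x ≡ y) → Injective _≡_ _≡_ f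
onto⇒injective onto {x} {x′} eq with onto⇒permutation onto
... | π , π≗f = trans (sym (inverseˡ π)) (trans (cong (π ⟨$⟩ˡ_) (trans (π≗f x) (trans eq (sym (π≗f x′))))) (inverseˡ π))

funToFin-cong : ∀ {m n} {f g : Fin m → Fin n} → f ≗ g → funToFin f ≡ funToFin g
funToFin-cong {zero}  f≗g = refl
funToFin-cong {suc m} f≗g = cong₂ combine (f≗g zero) (funToFin-cong (f≗g ∘ suc))

-- This is the dimension count over F₂: m < n bits cannot separate all vectors of F₂ⁿ. A colliding
-- pair plays the part of a nonzero kernel vector.
Bool^-pigeonhole : ∀ {m n} → m < n → (F : (Fin n → Bool) → (Fin m → Bool)) → ∃₂ λ x y → F x ≗ F y × ¬ x ≗ y
Bool^-pigeonhole {m} {n} m<n F = x , y , Fx≗Fy , x≭y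
  where
  open Inverse 2↔Bool
  decode : Fin (2 ^ n) → Fin n → Bool
  decode a = to ∘ finToFun a
  encode : (Fin m → Bool) → Fin (2 ^ m)
  encode z = funToFin (from ∘ z)
  collision : ∃₂ λ a b → a <ᶠ b × encode (F (decode a)) ≡ encode (F (decode b))
  collision = pigeonhole (ℕ.^-monoʳ-< 2 (s≤s (s≤s z≤n)) m<n) (encode ∘ F ∘ decode)
  a = proj₁ collision
  b = proj₁ (proj₂ collision)
  x = decode a
  y = decode b
  Fx≗Fy : F x ≗ F y
  Fx≗Fy i = from-injective (trans (sym (finToFun-funToFin (from ∘ F x) i))
    (trans (cong (λ e → finToFun e i) (proj₂ (proj₂ (proj₂ collision)))) (finToFun-funToFin (from ∘ F y) i)))
    where
    from-injective : ∀ {u v} → from u ≡ from v → u ≡ v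
    from-injective {u} {v} eq = trans (sym (strictlyInverseˡ u)) (trans (cong to eq) (strictlyInverseˡ v))
  x≭y : ¬ x ≗ y
  x≭y x≗y = <⇒≢ (proj₁ (proj₂ (proj₂ collision))) (trans (sym (funToFin-finToFin {n} a))
    (trans (funToFin-cong λ i → trans (sym (strictlyInverseʳ (finToFun a i))) (trans (cong from (x≗y i)) (strictlyInverseʳ (finToFun b i))))
    (funToFin-finToFin {n} b)))

open Algebra.Properties.CommutativeMonoid.Sum (CommutativeRing.+-commutativeMonoid xor-∧-commutativeRing)
  using (sum; sum-permute; sum-cong-≗)

sum-splitAt : ∀ m {n} (f : Fin m → Bool) (g : Fin n → Bool) → sum ([ f , g ]′ ∘ splitAt m) ≡ sum f xor sum g
sum-splitAt zero    f g = refl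
sum-splitAt (suc m) {n} f g = trans (cong (f zero xor_) (trans (sum-cong-≗ pointwise) (sum-splitAt m (f ∘ suc) g)))
  (sym (xor-assoc (f zero) (sum (f ∘ suc)) (sum g)))
  where
  pointwise : ∀ i → [ f , g ]′ (splitAt (suc m) (suc i)) ≡ [ f ∘ suc , g ]′ (splitAt m i)
  pointwise i with splitAt m {n} i
  ... | inj₁ _ = refl
  ... | inj₂ _ = refl

xor-cancelʳ : ∀ {a b} c → a xor c ≡ b xor c → a ≡ b
xor-cancelʳ {false} {false} c _ = refl
xor-cancelʳ {true}  {true}  c _ = refl
xor-cancelʳ {false} {true} false ()
xor-cancelʳ {false} {true} true  ()
xor-cancelʳ {true} {false} false ()
xor-cancelʳ {true} {false} true  ()

-- Upper bounds from the degrees of b-vertices.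

module Bounds (m t : ℕ) where
  private
    n : ℕ
    n = suc m
  open Corona (K n) (P t) using (CVertex)
  open Graph (K n ⊡ P t) using (_∼_)
  open Graph (P t) using () renaming (_∼_ to _↔ₚ_)
  open Graph (K n) using (_isEndOf_; Edge)

  core : Fin n → CVertex
  core i = inj₁ (inj₁ i)

  onEdge : Edge → CVertex
  onEdge e = inj₁ (inj₂ e)

  edgeAt : Fin n → Fin m → Edge
  edgeAt i j = edge i (punchIn i j) (punchInᵢ≢i i j ∘ sym)

  edgeAt-onto : ∀ {i} e → i isEndOf e → ∃[ j ] edgeAt i j ≡ e
  edgeAt-onto {i} e i∈e = punchOut i≢k , trans (edge-cong (punchIn-punchOut i≢k)) edge≡e
    where
    edge-cong : ∀ {j k} .{i≢j : i ≢ j} .{i≢k : i ≢ k} → j ≡ k → edge i j i≢j ≡ edge i k i≢k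
    edge-cong refl = refl

    ordered : ∀ {j k} .(p : j <ᶠ k × j ≢ k) → edge j k (proj₂ p) ≡ ((j , k) , [ p ])
    ordered {j} {k} p with <-cmp j k
    ... | tri< _ _ _   = refl
    ... | tri≈ _ j≡k _ = ⊥-elim-irr (proj₂ p j≡k)
    ... | tri> j≮k _ _ = ⊥-elim-irr (j≮k (proj₁ p))

    reversed : ∀ {j k} .(p : j <ᶠ k × j ≢ k) → edge k j (proj₂ p ∘ sym) ≡ ((j , k) , [ p ])
    reversed {j} {k} p with <-cmp k j
    ... | tri< _ _ k≯j = ⊥-elim-irr (k≯j (proj₁ p))
    ... | tri≈ _ k≡j _ = ⊥-elim-irr (proj₂ p (sym k≡j))
    ... | tri> _ _ _   = refl

    other : ∀ e → i isEndOf e → ∃[ k ] ∃[ i≢k ] edge i k i≢k ≡ e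
    other e@(_ , [ p ]) (inj₁ refl) = _ , ends-≢ e , ordered p
    other e@(_ , [ p ]) (inj₂ refl) = _ , ends-≢ e ∘ sym , reversed p

    i≢k    = proj₁ (proj₂ (other e i∈e))
    edge≡e = proj₂ (proj₂ (other e i∈e))

  #edges : ℕ
  #edges = proj₁ (edges-finite (K n))

  -- The neighbours that the end i contributes to each of its edges.
  group : Fin n → Fin (suc t) → CVertex
  group i zero    = core i
  group i (suc h) = inj₂ (i , h)

  edgeNeighbour : Edge → Fin (suc t + suc t) → CVertex
  edgeNeighbour e = [ group (proj₁ (value e)) , group (proj₂ (value e)) ]′ ∘ splitAt (suc t)

  edgeNeighbour-onto : ∀ e v → onEdge e ∼ v → ∃[ x ] edgeNeighbour e x ≡ v
  edgeNeighbour-onto e v e∼v = join (suc t) (suc t) (proj₁ (locate v e∼v)) ,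
    trans (cong [ _ , _ ]′ (splitAt-join (suc t) (suc t) (proj₁ (locate v e∼v)))) (proj₂ (locate v e∼v))
    where
    locate : ∀ v → onEdge e ∼ v → ∃[ s ] [ group (proj₁ (value e)) , group (proj₂ (value e)) ]′ s ≡ v
    locate (inj₁ (inj₁ i)) (inj₁ refl) = inj₁ zero , refl
    locate (inj₁ (inj₁ i)) (inj₂ refl) = inj₂ zero , refl
    locate (inj₂ (i , h))  (inj₁ refl) = inj₁ (suc h) , refl
    locate (inj₂ (i , h))  (inj₂ refl) = inj₂ (suc h) , refl

  module _ {l : ℕ} (c : CVertex → Fin l) where
    private
      IsB : CVertex → Set
      IsB = IsBVertex (K n ⊡ P t) c

    closedNeighbour : ∀ {d} → CVertex → (Fin d → CVertex) → Fin (suc d) → CVertex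
    closedNeighbour v nb zero    = v
    closedNeighbour v nb (suc x) = nb x

    -- All l colours occur in the closed neighbourhood of a b-vertex, so l is at most its degree
    -- plus one. It is enough that `nb` covers the neighbours; it may hit other vertices too.
    b-vertex-onto : ∀ {d v} (nb : Fin d → CVertex) → (∀ w → v ∼ w → ∃[ x ] nb x ≡ w) →
      IsB v → ∀ y → ∃[ x ] c (closedNeighbour v nb x) ≡ y
    b-vertex-onto {v = v} nb nb-onto isB y with y ≟ᶠ c v
    ... | yes eq = zero , sym eq
    ... | no y≢ with isB y y≢
    ...   | w , v∼w , eq with nb-onto w v∼w
    ...     | x , refl = suc x , eq

    core-bound : ∀ {i} → IsB (core i) → l ≤ n
    core-bound {i} isB = onto⇒≤ (b-vertex-onto (onEdge ∘ edgeAt i) neighbours isB)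
      where
      neighbours : ∀ w → core i ∼ w → ∃[ x ] onEdge (edgeAt i x) ≡ w
      neighbours (inj₁ (inj₂ e)) p with edgeAt-onto e p
      ... | j , refl = j , refl

    edge-onto : ∀ {e} → IsB (onEdge e) → ∀ y → ∃[ x ] c (closedNeighbour (onEdge e) (edgeNeighbour e) x) ≡ y
    edge-onto {e} = b-vertex-onto (edgeNeighbour e) (edgeNeighbour-onto e)

    edge-bound : ∀ {e} → IsB (onEdge e) → l ≤ suc (suc t + suc t)
    edge-bound isB = onto⇒≤ (edge-onto isB)

    path-bound : ∀ {a i h} (pn : Fin a → Fin t) → (∀ h′ → h ↔ₚ h′ → ∃[ x ] pn x ≡ h′) →
      IsB (inj₂ (i , h)) → l ≤ a + n
    path-bound {a} {i} {h} pn pn-onto isB =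
      subst (l ≤_) (sym (ℕ.+-suc a m)) (onto⇒≤ (b-vertex-onto ([ onPath , onEdgeAt ]′ ∘ splitAt a) neighbours isB))
      where
      onPath : Fin a → CVertex
      onPath x = inj₂ (i , pn x)
      onEdgeAt : Fin m → CVertex
      onEdgeAt j = onEdge (edgeAt i j)
      locate : ∀ w → inj₂ (i , h) ∼ w → ∃[ s ] [ onPath , onEdgeAt ]′ s ≡ w
      locate (inj₁ (inj₂ e)) p with edgeAt-onto e p
      ... | j , refl = inj₂ j , refl
      locate (inj₂ (.i , h′)) (refl , p) with pn-onto h′ p
      ... | x , refl = inj₁ x , refl
      neighbours : ∀ w → inj₂ (i , h) ∼ w → ∃[ x ] [ onPath , onEdgeAt ]′ (splitAt a x) ≡ w
      neighbours w p = join a m (proj₁ (locate w p)) ,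
        trans (cong [ onPath , onEdgeAt ]′ (splitAt-join a m (proj₁ (locate w p)))) (proj₂ (locate w p))

    copy-bound : ∀ {i h} → IsB (inj₂ (i , h)) → l ≤ 2 + n
    copy-bound {i} {h} = path-bound pn pn-onto
      where
      -- At an end of the path the missing neighbour is replaced by h itself, through `pred zero` or
      -- this default.
      next : Dec (suc (toℕ h) < t) → Fin t
      next (yes h+1<t) = fromℕ< h+1<t
      next (no _)      = h
      pn : Fin 2 → Fin t
      pn zero       = pred h
      pn (suc zero) = next (suc (toℕ h) <? t)
      pn-onto : ∀ h′ → h ↔ₚ h′ → ∃[ x ] pn x ≡ h′
      pn-onto h′ (inj₁ h+1≡h′) with suc (toℕ h) <? t in eq
      ... | yes h+1<t = suc zero , trans (cong next eq) (toℕ-injective (trans (toℕ-fromℕ< h+1<t) h+1≡h′))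
      ... | no h+1≮t  = contradiction (subst (_< t) (sym h+1≡h′) (toℕ<n h′)) h+1≮t
      pn-onto h′ (inj₂ h′+1≡h) = zero , pred-≡ h h′ h′+1≡h
        where
        pred-≡ : ∀ {k} (h h′ : Fin k) → suc (toℕ h′) ≡ toℕ h → pred h ≡ h′
        pred-≡ (suc h) h′ eq = toℕ-injective (trans (toℕ-inject₁ h) (sym (ℕ.suc-injective eq)))

    edgeColour : Fin #edges → Fin l
    edgeColour = c ∘ onEdge ∘ Inverse.from (proj₂ (edges-finite (K n)))

    edgeColour-onto : ∀ e → ∃[ x ] edgeColour x ≡ c (onEdge e)
    edgeColour-onto e = to e , cong (c ∘ onEdge) (strictlyInverseʳ e)
      where open Inverse (proj₂ (edges-finite (K n)))

module _ (m t : ℕ) {l : ℕ} (coloring : HasBChromaticColoring (K (suc m) ⊡ P t) l) (l≰ : ¬ l ≤ 3 + m) where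
  open Bounds m t
  private
    c = proj₁ coloring
    b = proj₂ (proj₂ coloring)

  -- Here uᵢ has degree n - 1 and a path vertex at most n + 1, too few for more than n + 2 colours.
  edge-b-vertex : ∀ y → ∃[ e ] (c (onEdge e) ≡ y × IsBVertex (K (suc m) ⊡ P t) c (onEdge e))
  edge-b-vertex y with b y
  ... | inj₁ (inj₁ i) , _ , isB  = contradiction (ℕ.≤-trans (core-bound c isB) (ℕ.m≤n+m (suc m) 2)) l≰
  ... | inj₁ (inj₂ e) , eq , isB = e , eq , isB
  ... | inj₂ (i , h)  , _ , isB  = contradiction (copy-bound c isB) l≰

  colours≤#edges : l ≤ #edges
  colours≤#edges = onto⇒≤ {f = edgeColour c} onto
    where
    onto : ∀ y → ∃[ x ] edgeColour c x ≡ y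
    onto y with edge-b-vertex y
    ... | e , refl , _ = edgeColour-onto c e

  colours≤edge-degree : l ≤ suc (suc t + suc t)
  colours≤edge-degree = edge-bound c (proj₂ (proj₂ (edge-b-vertex (fromℕ< (ℕ.m<n⇒0<n (ℕ.≰⇒> l≰))))))

-- Upper bounds for the three-vertex path.

module P₃-Bounds (m : ℕ) {l : ℕ} (coloring : HasBChromaticColoring (K (suc m) ⊡ P 3) l) (2+m<l : 2 + m < l) where
  private
    n : ℕ
    n = suc m
  open Bounds m 3
  open Corona (K n) (P 3) using (CVertex)
  open Graph (K n ⊡ P 3) using (_∼_)
  open Graph (K n) using (_isEndOf_; Edge)
  private
    c : CVertex → Fin l
    c = proj₁ coloring
    proper = proj₁ (proj₂ coloring)
    b = proj₂ (proj₂ coloring)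

    IsB : CVertex → Set
    IsB = IsBVertex (K n ⊡ P 3) c

  centre : Fin n → CVertex
  centre i = inj₂ (i , # 1)

  CentreOrEdge : Fin l → Set
  CentreOrEdge y = (∃[ i ] (c (centre i) ≡ y × IsB (centre i))) ⊎ (∃[ e ] (c (onEdge e) ≡ y × IsB (onEdge e)))

  path-end-bound : ∀ {i h} → (∀ h′ → Graph._∼_ (P 3) h h′ → # 1 ≡ h′) → IsB (inj₂ (i , h)) → l ≤ 1 + n
  path-end-bound only = path-bound c {1} (λ _ → # 1) (λ h′ p → zero , only h′ p)

  -- The ends of a path have degree n, too few for l > n + 1 colours.
  centre-or-edge : ∀ y → CentreOrEdge y
  centre-or-edge y with b y
  ... | inj₁ (inj₁ i)                 , _  , isB = contradiction (ℕ.m≤n⇒m≤1+n (core-bound c isB)) (ℕ.<⇒≱ 2+m<l)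
  ... | inj₁ (inj₂ e)                 , eq , isB = inj₂ (e , eq , isB)
  ... | inj₂ (i , zero)               , _  , isB = contradiction (path-end-bound only isB) (ℕ.<⇒≱ 2+m<l)
    where
    only : ∀ h′ → Graph._∼_ (P 3) zero h′ → # 1 ≡ h′
    only (suc zero) _ = refl
    only zero (inj₁ ())
    only zero (inj₂ ())
    only (suc (suc zero)) (inj₁ ())
    only (suc (suc zero)) (inj₂ ())
  ... | inj₂ (i , suc zero)           , eq , isB = inj₁ (i , eq , isB)
  ... | inj₂ (i , suc (suc zero))     , _  , isB = contradiction (path-end-bound only isB) (ℕ.<⇒≱ 2+m<l)
    where
    only : ∀ h′ → Graph._∼_ (P 3) (# 2) h′ → # 1 ≡ h′
    only (suc zero) _ = refl
    only zero (inj₁ ())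
    only zero (inj₂ ())
    only (suc (suc zero)) (inj₁ ())
    only (suc (suc zero)) (inj₂ ())

  colours≤n+#edges : l ≤ n + #edges
  colours≤n+#edges = onto⇒≤ {f = f ∘ splitAt n} λ y → join n #edges (proj₁ (onto y)) ,
    trans (cong f (splitAt-join n #edges (proj₁ (onto y)))) (proj₂ (onto y))
    where
    f : Fin n ⊎ Fin #edges → Fin l
    f = [ c ∘ centre , edgeColour c ]′
    onto : ∀ y → ∃[ s ] f s ≡ y
    onto y with centre-or-edge y
    ... | inj₁ (i , eq , _)   = inj₁ i , eq
    ... | inj₂ (e , refl , _) = inj₂ (proj₁ (edgeColour-onto c e)) , proj₂ (edgeColour-onto c e)

  Repeats : Fin n → Set
  Repeats i = ∃[ h ] c (core i) ≡ c (inj₂ (i , h))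

  repeats? : ∀ i → Dec (Repeats i)
  repeats? i = any? λ h → c (core i) ≟ᶠ c (inj₂ (i , h))

  -- The colours at the edges of i are seen by both the centre of the copy and uᵢ.
  centre-repeats : ∀ i → IsB (centre i) → Repeats i
  centre-repeats i isB with c (core i) ≟ᶠ c (centre i)
  ... | yes eq = # 1 , eq
  ... | no neq with isB (c (core i)) neq
  ...   | inj₁ (inj₂ e)  , p          , eq = contradiction (sym eq) (proper (core i) (onEdge e) p)
  ...   | inj₂ (.i , h)  , (refl , _) , eq = h , sym eq

  -- x represents a functional on F₂ˡ, evaluated here at the vectors that would span it.
  signature : (Fin l → Bool) → Fin (suc n) → Bool
  signature x zero    = sum x
  signature x (suc i) = if does (repeats? i) then x (c (centre i)) else sum (x ∘ c ∘ group i)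

  signature-repeats : ∀ x {i} → Repeats i → signature x (suc i) ≡ x (c (centre i))
  signature-repeats x {i} r = cong (if_then x (c (centre i)) else sum (x ∘ c ∘ group i)) (dec-true (repeats? i) r)

  signature-distinct : ∀ x {i} → ¬ Repeats i → signature x (suc i) ≡ sum (x ∘ c ∘ group i)
  signature-distinct x {i} ¬r = cong (if_then x (c (centre i)) else sum (x ∘ c ∘ group i)) (dec-false (repeats? i) ¬r)

  module _ (l≡9 : l ≡ 9) {e : Edge} (isB : IsB (onEdge e)) where
    private
      i j : Fin n
      i = proj₁ (value e)
      j = proj₂ (value e)

      at : Fin 4 ⊎ Fin 4 → CVertex
      at = [ group i , group j ]′

      f : Fin 9 → Fin l
      f x = c (closedNeighbour c (onEdge e) (edgeNeighbour e) x)

      -- The 1 + 4 + 4 vertices around e carry all nine colours, so each colour occurs once.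
      f-injective : ∀ x y → f x ≡ f y → x ≡ y
      f-injective x y = go l≡9 f (edge-onto c isB)
        where
        go : ∀ {k} → k ≡ 9 → (f : Fin 9 → Fin k) → (∀ y → ∃[ x ] f x ≡ y) → f x ≡ f y → x ≡ y
        go refl f onto = onto⇒injective onto

      at-join : ∀ s → c (at s) ≡ f (suc (join 4 4 s))
      at-join s = cong (c ∘ at) (sym (splitAt-join 4 4 s))

      at-injective : ∀ {s s′} → c (at s) ≡ c (at s′) → s ≡ s′
      at-injective {s} {s′} eq = trans (sym (splitAt-join 4 4 s)) (trans
        (cong (splitAt 4) (suc-injective (f-injective (suc (join 4 4 s)) (suc (join 4 4 s′)) (trans (sym (at-join s)) (trans eq (at-join s′))))))
        (splitAt-join 4 4 s′))

    end-distinct : ∀ {k} → k isEndOf e → ¬ Repeats k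
    end-distinct (inj₁ refl) (h , eq) with at-injective {inj₁ zero} {inj₁ (suc h)} eq
    ... | ()
    end-distinct (inj₂ refl) (h , eq) with at-injective {inj₂ zero} {inj₂ (suc h)} eq
    ... | ()

    sum-around : ∀ x → sum x ≡ x (c (onEdge e)) xor (sum (x ∘ c ∘ group i) xor sum (x ∘ c ∘ group j))
    sum-around x = begin
      sum x                                                  ≡⟨ permuted l≡9 f (edge-onto c isB) x ⟩
      sum (x ∘ f)                                            ≡⟨⟩
      x (c (onEdge e)) xor sum ([ x ∘ c ∘ group i , x ∘ c ∘ group j ]′ ∘ splitAt 4)
        ≡⟨ cong (x (c (onEdge e)) xor_) (sum-splitAt 4 (x ∘ c ∘ group i) (x ∘ c ∘ group j)) ⟩
      x (c (onEdge e)) xor (sum (x ∘ c ∘ group i) xor sum (x ∘ c ∘ group j)) ∎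
      where
      open ≡-Reasoning
      permuted : ∀ {k} → k ≡ 9 → (f : Fin 9 → Fin k) → (∀ y → ∃[ x ] f x ≡ y) → ∀ x → sum x ≡ sum (x ∘ f)
      permuted refl f onto x with onto⇒permutation onto
      ... | π , π≗f = trans (sum-permute x π) (sum-cong-≗ (cong x ∘ π≗f))

  -- By `end-distinct` the signature records the group sums of both ends of e, and it records
  -- `sum x`; `sum-around` then determines the value at the colour of e.
  edge-determined : l ≡ 9 → ∀ {e} → IsB (onEdge e) → ∀ {x y} → signature x ≗ signature y →
    x (c (onEdge e)) ≡ y (c (onEdge e))
  edge-determined l≡9 {e} isB {x} {y} same = xor-cancelʳ _ (begin
    x (c (onEdge e)) xor (X i xor X j) ≡⟨ sum-around l≡9 isB x ⟨
    sum x                              ≡⟨ same zero ⟩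
    sum y                              ≡⟨ sum-around l≡9 isB y ⟩
    y (c (onEdge e)) xor (Y i xor Y j) ≡⟨ cong (y (c (onEdge e)) xor_) (cong₂ _xor_ (X≡Y (inj₁ refl)) (X≡Y (inj₂ refl))) ⟨
    y (c (onEdge e)) xor (X i xor X j) ∎)
    where
    open ≡-Reasoning
    i j : Fin n
    i = proj₁ (value e)
    j = proj₂ (value e)
    X Y : Fin n → Bool
    X k = sum (x ∘ c ∘ group k)
    Y k = sum (y ∘ c ∘ group k)
    X≡Y : ∀ {k} → k isEndOf e → X k ≡ Y k
    X≡Y {k} k∈e = trans (sym (signature-distinct x ¬r)) (trans (same (suc k)) (signature-distinct y ¬r))
      where
      ¬r : ¬ Repeats k
      ¬r = end-distinct l≡9 isB k∈e

  contradictory : 7 ≤ n → ⊥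
  contradictory 7≤n with Bool^-pigeonhole 2+m<l signature
  ... | x , y , same , x≭y = x≭y determined
    where
    -- An edge vertex has degree 8, so a b-vertex on an edge forces l = 9; for larger l only the
    -- centres occur below.
    9≤l : 9 ≤ l
    9≤l = ℕ.≤-trans (ℕ.+-monoʳ-≤ 2 7≤n) 2+m<l
    determined : x ≗ y
    determined z with centre-or-edge z
    ... | inj₁ (i , refl , isB) = trans (sym (signature-repeats x r)) (trans (same (suc i)) (signature-repeats y r))
      where
      r : Repeats i
      r = centre-repeats i isB
    ... | inj₂ (e , refl , isB) = edge-determined (ℕ.≤-antisym (edge-bound c isB) 9≤l) isB same

-- Assembly of the cases.

K₂⊡P₃-upper : ∀ l → HasBChromaticColoring (K 2 ⊡ P 3) l → l ≤ 3
K₂⊡P₃-upper l χ with l ≤? 3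
... | yes l≤3 = l≤3
... | no l≰3  = P₃-Bounds.colours≤n+#edges 1 χ (ℕ.≰⇒> l≰3)

n+1-upper : ∀ n → 7 ≤ n → ∀ l → HasBChromaticColoring (K n ⊡ P 3) l → l ≤ 1 + n
n+1-upper (suc m) 7≤n l χ with l ≤? 2 + m
... | yes l≤ = l≤
... | no l≰  = ⊥-elim (P₃-Bounds.contradictory m χ (ℕ.≰⇒> l≰) 7≤n)

-- Meant for n = 2, 3, 4, with 1, 3, 6 edges against n + 2 = 4, 5, 6.
n+2-upper-few-edges : ∀ m t → Bounds.#edges m t ≤ 3 + m → ∀ l → HasBChromaticColoring (K (suc m) ⊡ P t) l → l ≤ 3 + m
n+2-upper-few-edges m t few l χ with l ≤? 3 + m
... | yes l≤ = l≤
... | no l≰  = ℕ.≤-trans (colours≤#edges m t χ l≰) few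

-- A b-vertex on an edge gives l ≤ 2t + 3 ≤ n + 2.
n+2-upper-large : ∀ n t → 2 * t + 1 ≤ n → ∀ l → HasBChromaticColoring (K n ⊡ P t) l → l ≤ 2 + n
n+2-upper-large zero t 2t+1≤0 l χ = contradiction (ℕ.≤-trans (ℕ.m≤n+m 1 (2 * t)) 2t+1≤0) ℕ.1+n≰n
n+2-upper-large (suc m) t 2t+1≤n l χ with l ≤? 3 + m
... | yes l≤ = l≤
... | no l≰  = ℕ.≤-trans (colours≤edge-degree m t χ l≰) (subst (_≤ 3 + m) degree (ℕ.+-monoʳ-≤ 2 2t+1≤n))
  where
  degree : 2 + (2 * t + 1) ≡ suc (suc t + suc t)
  degree = solve 1 (λ t → con 2 :+ (con 2 :* t :+ con 1) := con 1 :+ ((con 1 :+ t) :+ (con 1 :+ t))) refl t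
    where open +-*-Solver

n+2-lower : ∀ n t → 3 ≤ n → 4 ≤ t → HasBChromaticColoring (K n ⊡ P t) (2 + n)
n+2-lower (suc (suc (suc n′))) (suc (suc (suc (suc t′)))) (s≤s (s≤s (s≤s z≤n))) (s≤s (s≤s (s≤s (s≤s z≤n)))) = LongPath.n+2-colouring n′ t′

n+1-lower : ∀ n → 7 ≤ n → HasBChromaticColoring (K n ⊡ P 3) (1 + n)
n+1-lower (suc (suc (suc (suc (suc (suc (suc n′))))))) (s≤s (s≤s (s≤s (s≤s (s≤s (s≤s (s≤s z≤n))))))) = ThreeVertexPath.n+1-colouring n′

theorem20 : ∀ (n t : ℕ) → 1 < n → 2 < t →
    (((n ≡ 2 × t ≡ 3) ⊎ (7 ≤ n × t ≡ 3)) → IsBChromaticNumber (K n ⊡ P t) (n + 1))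
    × (((n ≡ 2 × 3 < t) ⊎ (n ≡ 3 ⊎ n ≡ 4) ⊎ (2 * t + 1 ≤ n × 7 < 2 * t + 1)) → IsBChromaticNumber (K n ⊡ P t) (n + 2))
theorem20 n t 1<n 2<t = one , two
  where
  one : ((n ≡ 2 × t ≡ 3) ⊎ (7 ≤ n × t ≡ 3)) → IsBChromaticNumber (K n ⊡ P t) (n + 1)
  one (inj₁ (refl , refl)) = K₂⊡P₃ , K₂⊡P₃-upper
  one (inj₂ (7≤n , refl))  = subst (IsBChromaticNumber (K n ⊡ P 3)) (ℕ.+-comm 1 n) (n+1-lower n 7≤n , n+1-upper n 7≤n)

  small : ∀ m → HasBChromaticColoring (K (suc m) ⊡ P t) (3 + m) → Bounds.#edges m t ≤ 3 + m →
    IsBChromaticNumber (K (suc m) ⊡ P t) (suc m + 2)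
  small m χ few = subst (IsBChromaticNumber (K (suc m) ⊡ P t)) (ℕ.+-comm 2 (suc m)) (χ , n+2-upper-few-edges m t few)

  two : ((n ≡ 2 × 3 < t) ⊎ (n ≡ 3 ⊎ n ≡ 4) ⊎ (2 * t + 1 ≤ n × 7 < 2 * t + 1)) → IsBChromaticNumber (K n ⊡ P t) (n + 2)
  two (inj₁ (refl , 3<t)) = small 1 (lower t 3<t) (ℕ.≤ᵇ⇒≤ _ _ _)
    where
    lower : ∀ t → 3 < t → HasBChromaticColoring (K 2 ⊡ P t) 4
    lower (suc (suc (suc (suc t′)))) (s≤s (s≤s (s≤s (s≤s z≤n)))) = K₂⊡P.four-colouring t′
  two (inj₂ (inj₁ (inj₁ refl))) = small 2 lower (ℕ.≤ᵇ⇒≤ _ _ _)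
    where
    lower : HasBChromaticColoring (K 3 ⊡ P t) 5
    lower with ℕ.m≤n⇒m<n∨m≡n 2<t
    ... | inj₁ 3<t  = n+2-lower 3 t ℕ.≤-refl 3<t
    ... | inj₂ refl = K₃⊡P₃
  two (inj₂ (inj₁ (inj₂ refl))) = small 3 lower (ℕ.≤ᵇ⇒≤ _ _ _)
    where
    lower : HasBChromaticColoring (K 4 ⊡ P t) 6
    lower with ℕ.m≤n⇒m<n∨m≡n 2<t
    ... | inj₁ 3<t  = n+2-lower 4 t (s≤s (s≤s (s≤s z≤n))) 3<t
    ... | inj₂ refl = K₄⊡P₃
  two (inj₂ (inj₂ (2t+1≤n , 7<2t+1))) = subst (IsBChromaticNumber (K n ⊡ P t)) (ℕ.+-comm 2 n)
    (n+2-lower n t (ℕ.≤-trans (s≤s (s≤s (s≤s z≤n))) (ℕ.≤-trans 7<2t+1 2t+1≤n)) 4≤t , n+2-upper-large n t 2t+1≤n)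
    where
    4≤t : 4 ≤ t
    4≤t with ℕ.m≤n⇒m<n∨m≡n 2<t
    ... | inj₁ 3<t  = 3<t
    -- For t = 3 the hypothesis would read 7 < 7.
    ... | inj₂ refl = contradiction 7<2t+1 (ℕ.<-irrefl refl)
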